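{- Let $m,n,s,k,t$ be positive integers and let $A$ be an $\mathrm{H}_t(m,n;s,k)$ that is simple with respect to the orderings $\omega_r$ (for the rows) and $\omega_c$ (for the columns). Then: (1) there exists a cyclic $s$-cycle decomposition $\mathcal{D}_{\omega_r}$ of $K_{\frac{2ms+t}{t}\times t}$; (2) there exists a cyclic $k$-cycle decomposition $\mathcal{D}_{\omega_c}$ of $K_{\frac{2nk+t}{t}\times t}$; (3) the cycle decompositions $\mathcal{D}_{\omega_r}$ and $\mathcal{D}_{\omega_c}$ are orthogonal. (Here $2ms+t=2nk+t$, so both are decompositions of the same graph, with vertex set $\mathbb{Z}_{2nk+t}$.)
   Context: A partially filled (p.f.) $m\times n$ array is an $m\times n$ matrix in which some cells are allowed to be empty. Let $v=2nk+t$ with $t$ dividing $2nk$, and let $J$ be the subgroup of $\mathbb{Z}_v$ of order $t$. An $\mathrm{H}_t(m,n;s,k)$ (Heffter array over $\mathbb{Z}_v$ relative to $J$) is an $m\times n$ p.f. array with elements in $\mathbb{Z}_v$ such that: each row contains exactly $s$ filled cells and each column contains exactly $k$ filled cells (so $ms=nk$); for every $x\in\mathbb{Z}_v\setminus J$, either $x$ or $-x$ appears in the array; the elements in every row and every column sum to $0$ in $\mathbb{Z}_v$. An ordering $(t_1,\ldots,t_\ell)$ of a finite subset of an abelian group is simple if the partial sums $s_i=\sum_{j=1}^i t_j$, $i=1,\ldots,\ell$, are pairwise distinct. The array is simple with respect to $\omega_r$ and $\omega_c$ if $\omega_r$ consists of a simple ordering of the elements of each row and $\omega_c$ consists of a simple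 ordering of the elements of each column. $\mathcal{D}_{\omega_r}$ is the set of all translates by elements of $\mathbb{Z}_v$ of the $m$ $s$-cycles whose consecutive vertices are the partial sums of the row orderings in $\omega_r$; $\mathcal{D}_{\omega_c}$ is obtained likewise from the $n$ column orderings in $\omega_c$, giving $k$-cycles. $K_{q\times r}$ is the complete multipartite graph with $q$ parts each of size $r$; here its vertex set is $\mathbb{Z}_v$ and its parts are the cosets of $J$. An $\ell$-cycle decomposition of a graph $K$ is a set of subgraphs of $K$, each a cycle of length $\ell$, whose edge sets partition $E(K)$. It is cyclic if it admits a cyclic group of automorphisms (bijections of $V(K)$ leaving the decomposition invariant) acting sharply transitively on $V(K)$. Two cycle decompositions $\mathcal{D},\mathcal{D}'$ of the same graph are orthogonal if every $B\in\mathcal{D}$ and every $B'\in\mathcal{D}'$ have at most one edge in common. -}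

module Defs where

open import Level using (0ℓ)
open import Data.Fin.Base using (Fin; toℕ)
open import Data.Fin.Properties using (toℕ-injective; toℕ-fromℕ<; toℕ<n)
open import Data.Fin.Subset using (Subset; _∈_; _∉_)
open import Data.Integer.Base using (ℤ; +_; -[1+_])
open import Data.List.Base
  using (List; []; _∷_; _∷ʳ_; catMaybes; drop; foldr; length; map; tabulate; zip)
open import Data.List.Membership.Propositional using () renaming (_∈_ to _∈ₗ_)
open import Data.List.Relation.Binary.Permutation.Propositional using (_↭_)
open import Data.List.Relation.Unary.Unique.Propositional using (Unique)
open import Data.List.Scans.Base using (scanl)
open import Data.Maybe.Base using (Maybe; just)
open import Data.Nat.Base as ℕ using (ℕ; NonZero; _≤_)
open import Data.Nat.DivMod using (_%_; _mod_; m%n<n; m<n⇒m%n≡m)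
open import Data.Nat.GeneralisedArithmetic using (iterate)
open import Data.Nat.Properties using (+-identityʳ)
open import Data.Product.Base using (∃; ∃-syntax; _×_; _,_)
open import Data.Sum.Base using (_⊎_)
open import Function.Bundles using (_↔_; _⇔_; module Inverse)
open import Relation.Binary.Core using (Rel)
open import Relation.Binary.PropositionalEquality
  using (_≡_; _≢_; sym; trans; cong; module ≡-Reasoning)
open import Relation.Nullary using (¬_)
open import Relation.Unary using (Pred)

------------------------------------------------------------------------
-- The group ℤ_v, carried by Fin v

module _ {v : ℕ} .{{_ : NonZero v}} where

  infixl 6 _⊕_
  infix  8 ⊖_

  0# : Fin v
  0# = 0 mod v

  _⊕_ : Fin v → Fin v → Fin v
  x ⊕ y = (toℕ x ℕ.+ toℕ y) mod v

  ⊖_ : Fin v → Fin v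
  ⊖ x = (v ℕ.∸ toℕ x) mod v

  ⊕-identityʳ : ∀ x → x ⊕ 0# ≡ x
  ⊕-identityʳ x = toℕ-injective (begin
    toℕ (x ⊕ 0#)                ≡⟨ toℕ-fromℕ< (m%n<n (toℕ x ℕ.+ toℕ 0#) v) ⟩
    (toℕ x ℕ.+ toℕ 0#) % v      ≡⟨ cong (λ z → (toℕ x ℕ.+ z) % v) toℕ-0# ⟩
    (toℕ x ℕ.+ 0) % v           ≡⟨ cong (_% v) (+-identityʳ (toℕ x)) ⟩
    toℕ x % v                   ≡⟨ m<n⇒m%n≡m (toℕ<n x) ⟩
    toℕ x                       ∎)
    where
    open ≡-Reasoning
    toℕ-0# : toℕ 0# ≡ 0
    toℕ-0# = trans (toℕ-fromℕ< (m%n<n 0 v)) (m<n⇒m%n≡m (ℕ.>-nonZero⁻¹ v))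

  sum : List (Fin v) → Fin v
  sum = foldr _⊕_ 0#

  record IsSubgroup (J : Subset v) : Set where
    field
      0-closed : 0# ∈ J
      ⊕-closed : ∀ {x y} → x ∈ J → y ∈ J → x ⊕ y ∈ J
      ⊖-closed : ∀ {x} → x ∈ J → ⊖ x ∈ J

  -- x lies in the coset z + J
  _∈coset_+_ : Fin v → Fin v → Subset v → Set
  x ∈coset z + J = ∃[ j ] j ∈ J × x ≡ z ⊕ j

  -- scanl also lists the empty sum 0#, which drop 1 removes:
  -- (t₁, …, tₗ) is sent to (s₁, …, sₗ) with sᵢ = t₁ + ⋯ + tᵢ.
  partialSums : List (Fin v) → List (Fin v)
  partialSums ts = drop 1 (scanl _⊕_ 0# ts)

  SimpleOrdering : List (Fin v) → Set
  SimpleOrdering ts = Unique (partialSums ts)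

------------------------------------------------------------------------
-- Partially filled arrays; nothing marks an empty cell

PFArray : Set → ℕ → ℕ → Set
PFArray X m n = Fin m → Fin n → Maybe X

module _ {X : Set} {m n : ℕ} where

  row : PFArray X m n → Fin m → List X
  row A i = catMaybes (tabulate (λ j → A i j))

  column : PFArray X m n → Fin n → List X
  column A j = catMaybes (tabulate (λ i → A i j))

  Appears : X → PFArray X m n → Set
  Appears x A = ∃[ i ] ∃[ j ] A i j ≡ just x

module _ {v : ℕ} .{{_ : NonZero v}} {m n : ℕ} where

  record IsHeffter (J : Subset v) (s k : ℕ) (A : PFArray (Fin v) m n) : Set where
    field
      row-filled    : ∀ i → length (row A i) ≡ s
      column-filled : ∀ j → length (column A j) ≡ k
      covers        : ∀ x → x ∉ J → Appears x A ⊎ Appears (⊖ x) A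
      row-sum       : ∀ i → sum (row A i) ≡ 0#
      column-sum    : ∀ j → sum (column A j) ≡ 0#

  record IsSimple (A : PFArray (Fin v) m n)
                  (ωr : Fin m → List (Fin v)) (ωc : Fin n → List (Fin v)) : Set where
    field
      row-ordering    : ∀ i → ωr i ↭ row A i
      row-simple      : ∀ i → SimpleOrdering (ωr i)
      column-ordering : ∀ j → ωc j ↭ column A j
      column-simple   : ∀ j → SimpleOrdering (ωc j)

------------------------------------------------------------------------
-- Graphs

-- A simple graph whose vertex set is the whole type V.
record Graph (V : Set) : Set₁ where
  field
    Adj    : Rel V 0ℓ
    symm   : ∀ {x y} → Adj x y → Adj y x
    irrefl : ∀ {x} → ¬ Adj x x

-- A simple graph whose vertex set is a subset of V.
record Subgraph (V : Set) : Set₁ where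
  field
    Vert      : Pred V 0ℓ
    Edge      : Rel V 0ℓ
    symm      : ∀ {x y} → Edge x y → Edge y x
    irrefl    : ∀ {x} → ¬ Edge x x
    edge⇒vert : ∀ {x y} → Edge x y → Vert x

-- A set of subgraphs; members are compared by _≈_ below.
SubgraphSet : Set → Set₁
SubgraphSet V = Pred (Subgraph V) 0ℓ

rotate : {X : Set} → List X → List X
rotate []       = []
rotate (x ∷ xs) = xs ∷ʳ x

module _ {V : Set} where

  open Subgraph

  _⊑_ : Subgraph V → Graph V → Set
  B ⊑ K = ∀ {x y} → Edge B x y → Graph.Adj K x y

  _≈_ : Subgraph V → Subgraph V → Set
  B ≈ B′ = (∀ x → Vert B x ⇔ Vert B′ x) × (∀ x y → Edge B x y ⇔ Edge B′ x y)

  -- B has vertex set {c₁, …, cₗ} and edge set {c₁c₂, …, cₗ₋₁cₗ, cₗc₁}.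
  _HasConsecutiveVertices_ : Subgraph V → List V → Set
  B HasConsecutiveVertices c =
      (∀ x → Vert B x ⇔ x ∈ₗ c)
    × (∀ x y → Edge B x y ⇔ ((x , y) ∈ₗ steps ⊎ (y , x) ∈ₗ steps))
    where
    steps : List (V × V)
    steps = zip c (rotate c)

  IsCycle : ℕ → Subgraph V → Set
  IsCycle ℓ B = 3 ≤ ℓ ×
    (∃[ c ] length c ≡ ℓ × Unique c × B HasConsecutiveVertices c)

  record IsCycleDecomposition (ℓ : ℕ) (K : Graph V) (D : SubgraphSet V) : Set₁ where
    field
      subgraphs : ∀ {B} → D B → B ⊑ K
      cycles    : ∀ {B} → D B → IsCycle ℓ B
      covering  : ∀ {x y} → Graph.Adj K x y → ∃[ B ] D B × Edge B x y
      disjoint  : ∀ {B B′ x y} → D B → D B′ → Edge B x y → Edge B′ x y → B ≈ B′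

  image : V ↔ V → Subgraph V → Subgraph V
  image σ B = record
    { Vert      = λ x → Vert B (from x)
    ; Edge      = λ x y → Edge B (from x) (from y)
    ; symm      = symm B
    ; irrefl    = irrefl B
    ; edge⇒vert = edge⇒vert B
    }
    where open Inverse σ

  IsAutomorphism : V ↔ V → SubgraphSet V → Set₁
  IsAutomorphism σ D = ∀ B → D B ⇔ D (image σ B)

  -- power σ i is the permutation σⁱ.
  power : V ↔ V → ℤ → V → V
  power σ (+ i)    x = iterate (Inverse.to σ) x i
  power σ -[1+ i ] x = iterate (Inverse.from σ) x (ℕ.suc i)

  -- The cyclic group ⟨σ⟩ has a unique element sending x to y, for all x, y.
  GeneratesSharplyTransitive : V ↔ V → Set
  GeneratesSharplyTransitive σ = ∀ x y →
    ∃[ i ] power σ i x ≡ y × (∀ j → power σ j x ≡ y → ∀ z → power σ j z ≡ power σ i z)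

  -- For a decomposition of a graph with vertex set V.  All of ⟨σ⟩ leaves D
  -- invariant as soon as its generator does.
  IsCyclic : SubgraphSet V → Set₁
  IsCyclic D = ∃[ σ ] IsAutomorphism σ D × GeneratesSharplyTransitive σ

  IsCyclicCycleDecomposition : ℕ → Graph V → SubgraphSet V → Set₁
  IsCyclicCycleDecomposition ℓ K D = IsCycleDecomposition ℓ K D × IsCyclic D

  SameEdge : V × V → V × V → Set
  SameEdge (x , y) (x′ , y′) = (x ≡ x′ × y ≡ y′) ⊎ (x ≡ y′ × y ≡ x′)

  Orthogonal : SubgraphSet V → SubgraphSet V → Set₁
  Orthogonal D D′ = ∀ {B B′} → D B → D′ B′ →
    ∀ {x y x′ y′} → Edge B x y → Edge B′ x y → Edge B x′ y′ → Edge B′ x′ y′ →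
    SameEdge (x , y) (x′ , y′)

  -- K is a K_{q×r}: part x is the index of the part containing x.
  record IsCompleteMultipartite (q r : ℕ) (K : Graph V) : Set where
    field
      part      : V → Fin q
      part-size : ∀ p → Fin r ↔ (∃[ x ] part x ≡ p)
      adjacent  : ∀ x y → Graph.Adj K x y ⇔ part x ≢ part y

------------------------------------------------------------------------
-- The graph and the cycle sets attached to an array over ℤ_v

module _ {v : ℕ} .{{_ : NonZero v}} where

  -- The complete multipartite graph on ℤ_v whose parts are the cosets of J.
  cosetGraph : (J : Subset v) → IsSubgroup J → Graph (Fin v)
  cosetGraph J J-sub = record
    { Adj    = λ x y → ¬ SameCoset x y
    ; symm   = λ x≁y (z , y∈ , x∈) → x≁y (z , x∈ , y∈)
    ; irrefl = λ {x} x≁x → x≁x (x , self x , self x)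
    }
    where
    SameCoset : Rel (Fin v) 0ℓ
    SameCoset x y = ∃[ z ] (x ∈coset z + J) × (y ∈coset z + J)

    self : ∀ x → x ∈coset x + J
    self x = 0# , IsSubgroup.0-closed J-sub , sym (⊕-identityʳ x)

  -- All translates of the cycles through the partial sums of ω i.
  cyclesOf : {m : ℕ} → (Fin m → List (Fin v)) → SubgraphSet (Fin v)
  cyclesOf ω B =
    ∃[ i ] ∃[ g ] B HasConsecutiveVertices map (g ⊕_) (partialSums (ω i))

{-# OPTIONS --safe #-}

-- The nk entries of the array and their nk negatives must cover the 2nk elements
-- of ℤ_v outside J, so these signed entries are pairwise distinct and avoid J.  A
-- cycle through the partial sums of a row has exactly the entries of that row as
-- its (oriented) differences.  Hence a pair of vertices from different cosets,
-- whose difference is ± a unique entry, lies on exactly one translate of one row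
-- cycle.  Edges common to a row cycle and a column cycle have as difference the
-- entry in the common cell, and a row cycle has only one edge with that difference.
--
-- The cosets of J are the residue classes mod q = v / t: the sum of J is invariant
-- under translation by j ∈ J, so t j = 0 in ℤ_v, that is q ∣ j, and there are
-- only t multiples of q.

module Submission where

open import Defs
open import Algebra.Bundles using (AbelianGroup; CommutativeMonoid)
import Algebra.Properties.AbelianGroup as AbelianGroupProperties
import Algebra.Properties.CommutativeSemigroup as CommutativeSemigroupProperties
open import Algebra.Structures using (IsAbelianGroup)
open import Data.Empty using (⊥; ⊥-elim)
open import Data.Fin.Base using (Fin; zero; suc; toℕ; combine; quotient; remainder)
open import Data.Fin.Properties
  using (suc-injective; toℕ-injective; toℕ-fromℕ<; toℕ<n; remQuot-combine; combine-remQuot; toℕ-combine)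
open import Data.Fin.Subset using (Subset; inside; outside; ∣_∣; ∁) renaming (_∈_ to _∈ₛ_; _∉_ to _∉ₛ_)
open import Data.Fin.Subset.Properties using (x∈∁p⇒x∉p; x∉p⇒x∈∁p; ∣∁p∣≡n∸∣p∣)
import Data.Integer.Base as ℤ
open import Data.List.Base
  using (List; []; _∷_; _++_; _∷ʳ_; [_]; map; concat; tabulate; length; catMaybes; drop; zip)
open import Data.List.Properties
  using (length-++; length-map; length-tabulate; map-++; map-∘; map-cong; zipWith-map; map-zipWith)
open import Data.List.Membership.Propositional using (_∈_; _∉_)
open import Data.List.Membership.Propositional.Properties
open import Data.List.Relation.Binary.Disjoint.Propositional using (Disjoint)
open import Data.List.Relation.Binary.Permutation.Propositional hiding (trans; swap)
import Data.List.Relation.Binary.Permutation.Propositional.Properties as Perm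
import Data.List.Relation.Binary.Permutation.Setoid.Properties as SetoidPerm
open import Data.List.Relation.Binary.Subset.Propositional using (_⊆_)
open import Data.List.Relation.Unary.All as All using ([]; _∷_)
import Data.List.Relation.Unary.All.Properties as All
open import Data.List.Relation.Unary.AllPairs using ([]; _∷_)
open import Data.List.Relation.Unary.Any using (here; there)
open import Data.List.Relation.Unary.Unique.Propositional using (Unique)
import Data.List.Relation.Unary.Unique.Propositional.Properties as Unique
open import Data.List.Scans.Base using (scanl)
open import Data.Maybe.Base using (Maybe; just; nothing)
open import Data.Maybe.Properties using (just-injective)
open import Data.Nat.Base
  using (ℕ; zero; suc; _+_; _*_; _∸_; _/_; _≤_; z≤n; s≤s; NonZero; ≢-nonZero⁻¹; >-nonZero)
open import Data.Nat.DivMod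
  using (_%_; _mod_; m%n<n; m<n⇒m%n≡m; %-distribˡ-+; n%n≡0; m*n%n≡0; [m+kn]%n≡m%n; m∣n⇒o%n%m≡o%m;
         m*[n/m]≡n; m≥n⇒m/n>0)
open import Data.Nat.Divisibility
  using (_∣_; n∣m*n; m%n≡0⇒n∣m; n∣m⇒m%n≡0; *-cancelˡ-∣; ∣m∣n⇒∣m+n; ∣-refl)
open import Data.Nat.GeneralisedArithmetic using (iterate)
import Data.Nat.Properties as ℕ
open import Data.Product.Base as Product using (∃-syntax; _×_; _,_; proj₁; proj₂)
open import Data.Sum.Base as Sum using (_⊎_; inj₁; inj₂)
open import Data.Vec.Base using (here; there) renaming ([] to []ᵥ; _∷_ to _∷ᵥ_)
open import Function.Base using (_∘_; id)
open import Function.Bundles using (_↔_; mk⇔; mk↔ₛ′; module Inverse; module Equivalence)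
open import Level using (0ℓ)
open import Relation.Binary.PropositionalEquality as ≡
  using (_≡_; _≢_; refl; cong; cong₂; sym; trans; subst; subst₂; module ≡-Reasoning)
open import Relation.Nullary using (contradiction)

open Equivalence using () renaming (to to ⇒; from to ⇐)
open Subgraph

-- Lists and permutations

module _ {X : Set} where

  Unique-resp-↭ : {xs ys : List X} → xs ↭ ys → Unique xs → Unique ys
  Unique-resp-↭ p = SetoidPerm.Unique-resp-↭ (≡.setoid X) (↭⇒↭ₛ p)

  -- Pigeonhole. Each `x` is removed from `ys` in turn: the rest of `xs` avoids `x`, so it still
  -- embeds in what is left, and the length bound leaves no surplus at the end. This turns an
  -- inclusion and a count into an equality three times: for the signed entries, for a translate of
  -- `J`, and for the multiples of `q`.
  unique-⊆⇒↭ : {xs ys : List X} → Unique xs → xs ⊆ ys → length ys ≤ length xs → xs ↭ ys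
  unique-⊆⇒↭ {[]}     {[]}     _        _   _ = ↭-refl
  unique-⊆⇒↭ {x ∷ xs} (x∉ ∷ u) sub len
    with ys₁ , ys₂ , refl ← ∈-∃++ (sub (here refl)) =
    ↭-trans (prep x (unique-⊆⇒↭ u sub′ len′)) (↭-sym (Perm.shift x ys₁ ys₂))
    where
    sub′ : xs ⊆ ys₁ ++ ys₂
    sub′ z∈xs with Perm.∈-resp-↭ (Perm.shift x ys₁ ys₂) (sub (there z∈xs))
    ... | here refl = contradiction refl (All.lookup x∉ z∈xs)
    ... | there z∈  = z∈

    len′ : length (ys₁ ++ ys₂) ≤ length xs
    len′ with s≤s le ← subst (_≤ _) (Perm.↭-length (Perm.shift x ys₁ ys₂)) len = le

  Unique-++⁻ : (xs : List X) {ys : List X} → Unique (xs ++ ys) →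
               Unique xs × Unique ys × Disjoint xs ys
  Unique-++⁻ []       u       = [] , u , λ ()
  Unique-++⁻ (x ∷ xs) (x∉ ∷ u) with u₁ , u₂ , dis ← Unique-++⁻ xs u =
    All.++⁻ˡ xs x∉ ∷ u₁ , u₂ , λ where
      (here refl , z∈ys) → All.lookup x∉ (∈-++⁺ʳ xs z∈ys) refl
      (there z∈ , z∈ys)  → dis (z∈ , z∈ys)

  ∈-concat-tabulate⁺ : ∀ {m} (f : Fin m → List X) i {x} → x ∈ f i → x ∈ concat (tabulate f)
  ∈-concat-tabulate⁺ f i x∈ = ∈-concat⁺′ x∈ (∈-tabulate⁺ i)

  ∈-concat-tabulate⁻ : ∀ {m} (f : Fin m → List X) {x} → x ∈ concat (tabulate f) → ∃[ i ] x ∈ f i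
  ∈-concat-tabulate⁻ f x∈ with ∈-concat⁻′ (tabulate f) x∈
  ... | _ , x∈ys , ys∈ with i , refl ← ∈-tabulate⁻ ys∈ = i , x∈ys

  concat-tabulate-unique⁻ : ∀ {m} (f : Fin m → List X) → Unique (concat (tabulate f)) →
                            ∀ i → Unique (f i)
  concat-tabulate-unique⁻ f u zero    = proj₁ (Unique-++⁻ (f zero) u)
  concat-tabulate-unique⁻ f u (suc i) =
    concat-tabulate-unique⁻ (f ∘ suc) (proj₁ (proj₂ (Unique-++⁻ (f zero) u))) i

  concat-tabulate-disjoint⁻ : ∀ {m} (f : Fin m → List X) → Unique (concat (tabulate f)) →
                              ∀ {x i j} → x ∈ f i → x ∈ f j → i ≡ j
  concat-tabulate-disjoint⁻ {suc m} f u {i = i} {j} x∈i x∈j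
    with u₁ , u₂ , dis ← Unique-++⁻ (f zero) u
    with i | j
  ... | zero  | zero  = refl
  ... | zero  | suc j = ⊥-elim (dis (x∈i , ∈-concat-tabulate⁺ (f ∘ suc) j x∈j))
  ... | suc i | zero  = ⊥-elim (dis (x∈j , ∈-concat-tabulate⁺ (f ∘ suc) i x∈i))
  ... | suc i | suc j = cong suc (concat-tabulate-disjoint⁻ (f ∘ suc) u₂ x∈i x∈j)

  concat-tabulate-cong-↭ : ∀ {m} {f g : Fin m → List X} → (∀ i → f i ↭ g i) →
                           concat (tabulate f) ↭ concat (tabulate g)
  concat-tabulate-cong-↭ {zero}  p = ↭-refl
  concat-tabulate-cong-↭ {suc m} p = Perm.++⁺ (p zero) (concat-tabulate-cong-↭ (p ∘ suc))

  length-concat-tabulate : ∀ {m} (f : Fin m → List X) {l} → (∀ i → length (f i) ≡ l) →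
                           length (concat (tabulate f)) ≡ m * l
  length-concat-tabulate {zero}  f len = refl
  length-concat-tabulate {suc m} f len =
    trans (length-++ (f zero))
            (cong₂ _+_ (len zero) (length-concat-tabulate (f ∘ suc) (len ∘ suc)))

  concat-tabulate-++ : ∀ {n} (f g : Fin n → List X) →
    concat (tabulate λ j → f j ++ g j) ↭ concat (tabulate f) ++ concat (tabulate g)
  concat-tabulate-++ {zero}  f g = ↭-refl
  concat-tabulate-++ {suc n} f g = begin
    (f₀ ++ g₀) ++ concat (tabulate λ j → f (suc j) ++ g (suc j))
      ↭⟨ Perm.++⁺ˡ (f₀ ++ g₀) (concat-tabulate-++ (f ∘ suc) (g ∘ suc)) ⟩
    (f₀ ++ g₀) ++ (F ++ G)   ↭⟨ Perm.++-assoc f₀ g₀ (F ++ G) ⟩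
    f₀ ++ (g₀ ++ (F ++ G))   ↭⟨ Perm.++⁺ˡ f₀ (Perm.shifts g₀ F) ⟩
    f₀ ++ (F ++ (g₀ ++ G))   ↭⟨ Perm.++-assoc f₀ F (g₀ ++ G) ⟨
    (f₀ ++ F) ++ (g₀ ++ G)   ∎
    where
    open PermutationReasoning
    f₀ g₀ F G : List X
    f₀ = f zero
    g₀ = g zero
    F  = concat (tabulate (f ∘ suc))
    G  = concat (tabulate (g ∘ suc))

  ∈-catMaybes-tabulate⁺ : ∀ {n} (f : Fin n → Maybe X) {x} j → f j ≡ just x →
                          x ∈ catMaybes (tabulate f)
  ∈-catMaybes-tabulate⁺ f zero    eq rewrite eq = here refl
  ∈-catMaybes-tabulate⁺ f (suc j) eq with f zero
  ... | just _  = there (∈-catMaybes-tabulate⁺ (f ∘ suc) j eq)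
  ... | nothing = ∈-catMaybes-tabulate⁺ (f ∘ suc) j eq

  ∈-catMaybes-tabulate⁻ : ∀ {n} (f : Fin n → Maybe X) {x} → x ∈ catMaybes (tabulate f) →
                          ∃[ j ] f j ≡ just x
  ∈-catMaybes-tabulate⁻ {suc n} f x∈ with f zero in eq | x∈
  ... | just _  | here refl = zero , eq
  ... | just _  | there x∈′ = let j , e = ∈-catMaybes-tabulate⁻ (f ∘ suc) x∈′ in suc j , e
  ... | nothing | x∈′       = let j , e = ∈-catMaybes-tabulate⁻ (f ∘ suc) x∈′ in suc j , e

  -- Writes a row as a concatenation of lists with at most one element, the form in which it appears
  -- when the first cell is split off every column.
  catMaybes-tabulate : ∀ {n} (f : Fin n → Maybe X) →
    catMaybes (tabulate f) ≡ concat (tabulate λ j → catMaybes [ f j ])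
  catMaybes-tabulate {zero}  f = refl
  catMaybes-tabulate {suc n} f with f zero
  ... | just x  = cong (x ∷_) (catMaybes-tabulate (f ∘ suc))
  ... | nothing = catMaybes-tabulate (f ∘ suc)

  catMaybes-∷ : (a : Maybe X) (as : List (Maybe X)) →
                catMaybes (a ∷ as) ≡ catMaybes [ a ] ++ catMaybes as
  catMaybes-∷ (just _) as = refl
  catMaybes-∷ nothing  as = refl

  concat-tabulate-[] : ∀ n → concat (tabulate {n = n} λ _ → []) ≡ ([] {A = X})
  concat-tabulate-[] zero    = refl
  concat-tabulate-[] (suc n) = concat-tabulate-[] n

  -- Double counting, by induction on the rows: the first cells of all columns, collected by
  -- `concat-tabulate-++`, make up the first row. What is counted along columns thereby passes to
  -- rows.
  columns↭rows : ∀ {m n} (A : PFArray X m n) →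
                 concat (tabulate (column A)) ↭ concat (tabulate (row A))
  columns↭rows {zero}  {n} A = ↭-reflexive (concat-tabulate-[] n)
  columns↭rows {suc m}     A = begin
    concat (tabulate (column A))
      ↭⟨ concat-tabulate-cong-↭ (λ j → ↭-reflexive (catMaybes-∷ (A zero j) (tabulate λ i → A (suc i) j))) ⟩
    concat (tabulate λ j → catMaybes [ A zero j ] ++ column (A ∘ suc) j)
      ↭⟨ concat-tabulate-++ (λ j → catMaybes [ A zero j ]) (column (A ∘ suc)) ⟩
    concat (tabulate λ j → catMaybes [ A zero j ]) ++ concat (tabulate (column (A ∘ suc)))
      ↭⟨ Perm.++⁺ (↭-reflexive (sym (catMaybes-tabulate (A zero)))) (columns↭rows (A ∘ suc)) ⟩
    row A zero ++ concat (tabulate (row (A ∘ suc)))  ∎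
    where open PermutationReasoning

-- Finite subsets as lists without repetition

elements : ∀ {n} → Subset n → List (Fin n)
elements []ᵥ            = []
elements (inside  ∷ᵥ p) = zero ∷ map suc (elements p)
elements (outside ∷ᵥ p) = map suc (elements p)

length-elements : ∀ {n} (p : Subset n) → length (elements p) ≡ ∣ p ∣
length-elements []ᵥ            = refl
length-elements (inside  ∷ᵥ p) = cong suc (trans (length-map suc (elements p)) (length-elements p))
length-elements (outside ∷ᵥ p) = trans (length-map suc (elements p)) (length-elements p)

∈-elements⁺ : ∀ {n} {p : Subset n} {x} → x ∈ₛ p → x ∈ elements p
∈-elements⁺ {p = inside  ∷ᵥ p} here       = here refl
∈-elements⁺ {p = inside  ∷ᵥ p} (there x∈) = there (∈-map⁺ suc (∈-elements⁺ x∈))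
∈-elements⁺ {p = outside ∷ᵥ p} (there x∈) = ∈-map⁺ suc (∈-elements⁺ x∈)

∈-elements⁻ : ∀ {n} (p : Subset n) {x} → x ∈ elements p → x ∈ₛ p
∈-elements⁻ (inside  ∷ᵥ p) (here refl) = here
∈-elements⁻ (inside  ∷ᵥ p) (there x∈) with _ , y∈ , refl ← ∈-map⁻ suc x∈ = there (∈-elements⁻ p y∈)
∈-elements⁻ (outside ∷ᵥ p) x∈         with _ , y∈ , refl ← ∈-map⁻ suc x∈ = there (∈-elements⁻ p y∈)

elements-unique : ∀ {n} (p : Subset n) → Unique (elements p)
elements-unique []ᵥ            = []
elements-unique (inside  ∷ᵥ p) =
  All.map⁺ (All.universal (λ _ ()) (elements p)) ∷ Unique.map⁺ suc-injective (elements-unique p)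
elements-unique (outside ∷ᵥ p) = Unique.map⁺ suc-injective (elements-unique p)

module _ {X : Set} where

  ∈-rotate⁺ : {x : X} (xs : List X) → x ∈ xs → x ∈ rotate xs
  ∈-rotate⁺ (y ∷ ys) (here refl) = ∈-++⁺ʳ ys (here refl)
  ∈-rotate⁺ (y ∷ ys) (there x∈)  = ∈-++⁺ˡ x∈

  ∈-rotate⁻ : {x : X} (xs : List X) → x ∈ rotate xs → x ∈ xs
  ∈-rotate⁻ (y ∷ ys) x∈ with ∈-++⁻ ys x∈
  ... | inj₁ x∈ys        = there x∈ys
  ... | inj₂ (here refl) = here refl

  ∈-zip⁻ : {Y : Set} {x : X} {y : Y} (xs : List X) (ys : List Y) → (x , y) ∈ zip xs ys → x ∈ xs × y ∈ ys
  ∈-zip⁻ (_ ∷ _)  (_ ∷ _)  (here refl) = here refl , here refl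
  ∈-zip⁻ (_ ∷ xs) (_ ∷ ys) (there xy∈) = let p , q = ∈-zip⁻ xs ys xy∈ in there p , there q

map-rotate : {X Y : Set} (f : X → Y) (xs : List X) → map f (rotate xs) ≡ rotate (map f xs)
map-rotate f []       = refl
map-rotate f (x ∷ xs) = map-++ f xs [ x ]

-- The group ℤ_v and walks in it

module _ {v : ℕ} .{{_ : NonZero v}} where

  toℕ-mod : ∀ a → toℕ (a mod v) ≡ a % v
  toℕ-mod a = toℕ-fromℕ< (m%n<n a v)

  mod-cong-% : ∀ {a b} → a % v ≡ b % v → a mod v ≡ b mod v
  mod-cong-% {a} {b} eq = toℕ-injective (trans (toℕ-mod a) (trans eq (sym (toℕ-mod b))))

  mod-toℕ : (x : Fin v) → toℕ x mod v ≡ x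
  mod-toℕ x = toℕ-injective (trans (toℕ-mod (toℕ x)) (m<n⇒m%n≡m (toℕ<n x)))

  mod-homo-+ : ∀ a b → (a + b) mod v ≡ a mod v ⊕ b mod v
  mod-homo-+ a b = mod-cong-% (trans (%-distribˡ-+ a b v)
    (cong₂ (λ x y → (x + y) % v) (sym (toℕ-mod a)) (sym (toℕ-mod b))))

  ⊕-comm : ∀ (x y : Fin v) → x ⊕ y ≡ y ⊕ x
  ⊕-comm x y = cong (_mod v) (ℕ.+-comm (toℕ x) (toℕ y))

  ⊕-assoc : ∀ (x y z : Fin v) → (x ⊕ y) ⊕ z ≡ x ⊕ (y ⊕ z)
  ⊕-assoc x y z = begin
    (a + b) mod v ⊕ z        ≡⟨ cong ((a + b) mod v ⊕_) (mod-toℕ z) ⟨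
    (a + b) mod v ⊕ c mod v  ≡⟨ mod-homo-+ (a + b) c ⟨
    (a + b + c) mod v        ≡⟨ cong (_mod v) (ℕ.+-assoc a b c) ⟩
    (a + (b + c)) mod v      ≡⟨ mod-homo-+ a (b + c) ⟩
    a mod v ⊕ (b + c) mod v  ≡⟨ cong (_⊕ (b + c) mod v) (mod-toℕ x) ⟩
    x ⊕ (y ⊕ z)              ∎
    where
    open ≡-Reasoning
    a b c : ℕ
    a = toℕ x
    b = toℕ y
    c = toℕ z

  ⊕-inverseʳ : ∀ (x : Fin v) → x ⊕ ⊖ x ≡ 0#
  ⊕-inverseʳ x = begin
    x ⊕ ⊖ x                            ≡⟨ cong (_⊕ ⊖ x) (mod-toℕ x) ⟨
    toℕ x mod v ⊕ (v ∸ toℕ x) mod v    ≡⟨ mod-homo-+ (toℕ x) (v ∸ toℕ x) ⟨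
    (toℕ x + (v ∸ toℕ x)) mod v        ≡⟨ cong (_mod v) (ℕ.m+[n∸m]≡n (ℕ.<⇒≤ (toℕ<n x))) ⟩
    v mod v                            ≡⟨ mod-cong-% (trans (n%n≡0 v) (sym (m*n%n≡0 0 v))) ⟩
    0#                                 ∎
    where open ≡-Reasoning

  ⊕-isAbelianGroup : IsAbelianGroup _≡_ (_⊕_ {v}) 0# ⊖_
  ⊕-isAbelianGroup = record
    { isGroup = record
      { isMonoid = record
        { isSemigroup = record
          { isMagma = record { isEquivalence = ≡.isEquivalence ; ∙-cong = cong₂ _⊕_ }
          ; assoc   = ⊕-assoc
          }
        ; identity = (λ x → trans (⊕-comm 0# x) (⊕-identityʳ x)) , ⊕-identityʳ
        }
      ; inverse = (λ x → trans (⊕-comm (⊖ x) x) (⊕-inverseʳ x)) , ⊕-inverseʳ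
      ; ⁻¹-cong = cong ⊖_
      }
    ; comm = ⊕-comm
    }

ℤ/ : (v : ℕ) .{{_ : NonZero v}} → AbelianGroup 0ℓ 0ℓ
ℤ/ v = record { isAbelianGroup = ⊕-isAbelianGroup {v} }

module ℤ/-Properties (v : ℕ) .{{_ : NonZero v}} where
  open AbelianGroup (ℤ/ v) public using (identityˡ; commutativeMonoid; _-_)
  open AbelianGroupProperties (ℤ/ v) public
  open CommutativeSemigroupProperties (AbelianGroup.commutativeSemigroup (ℤ/ v)) public
    using (interchange)

module _ {v : ℕ} .{{_ : NonZero v}} where
  open ℤ/-Properties v
  open ≡-Reasoning

  infixl 6 _⊝_
  _⊝_ : Fin v → Fin v → Fin v
  x ⊝ y = x - y

  x⊕[y⊝x]≡y : ∀ x y → x ⊕ (y ⊝ x) ≡ y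
  x⊕[y⊝x]≡y x y = trans (sym (⊕-assoc x y (⊖ x))) (xyx⁻¹≈y x y)

  [x⊝y]⊕y≡x : ∀ x y → x ⊝ y ⊕ y ≡ x
  [x⊝y]⊕y≡x x y = trans (⊕-comm (x ⊝ y) y) (x⊕[y⊝x]≡y y x)

  sum-↭ : {xs ys : List (Fin v)} → xs ↭ ys → sum xs ≡ sum ys
  sum-↭ p = SetoidPerm.foldr-commMonoid (≡.setoid (Fin v))
    (CommutativeMonoid.isCommutativeMonoid commutativeMonoid) (↭⇒↭ₛ p)

  -- The multiple of `j` is formed in ℕ and then reduced, so that its vanishing can later be read as
  -- a divisibility.
  sum-map-⊕ : ∀ j xs → sum (map (_⊕ j) xs) ≡ sum xs ⊕ (length xs * toℕ j) mod v
  sum-map-⊕ j []       = sym (⊕-identityʳ 0#)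
  sum-map-⊕ j (x ∷ xs) = begin
    (x ⊕ j) ⊕ sum (map (_⊕ j) xs)       ≡⟨ cong ((x ⊕ j) ⊕_) (sum-map-⊕ j xs) ⟩
    (x ⊕ j) ⊕ (sum xs ⊕ lj)             ≡⟨ interchange x j (sum xs) lj ⟩
    (x ⊕ sum xs) ⊕ (j ⊕ lj)             ≡⟨ cong (λ z → (x ⊕ sum xs) ⊕ (z ⊕ lj)) (mod-toℕ j) ⟨
    (x ⊕ sum xs) ⊕ (toℕ j mod v ⊕ lj)
      ≡⟨ cong ((x ⊕ sum xs) ⊕_) (mod-homo-+ (toℕ j) (length xs * toℕ j)) ⟨
    (x ⊕ sum xs) ⊕ (toℕ j + length xs * toℕ j) mod v ∎
    where
    lj : Fin v
    lj = (length xs * toℕ j) mod v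

  -- The directed walk from `a` with increments `ts`. It has no wrap-around, so memberships are open
  -- to induction; when `ts` sums to `0#` the walk closes, and its arcs are the steps of the cycle
  -- through the translated partial sums.
  arcs : Fin v → List (Fin v) → List (Fin v × Fin v)
  arcs a []       = []
  arcs a (t ∷ ts) = (a , a ⊕ t) ∷ arcs (a ⊕ t) ts

  map-scanl-⊕ : ∀ g a ts → map (g ⊕_) (scanl _⊕_ a ts) ≡ scanl _⊕_ (g ⊕ a) ts
  map-scanl-⊕ g a []       = refl
  map-scanl-⊕ g a (t ∷ ts) = cong (g ⊕ a ∷_) (trans (map-scanl-⊕ g (a ⊕ t) ts)
    (cong (λ z → scanl _⊕_ z ts) (sym (⊕-assoc g a t))))

  map-partialSums-∷ : ∀ g t ts → map (g ⊕_) (partialSums (t ∷ ts)) ≡ scanl _⊕_ (g ⊕ t) ts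
  map-partialSums-∷ g t ts = trans (map-scanl-⊕ g (0# ⊕ t) ts)
    (cong (λ z → scanl _⊕_ (g ⊕ z) ts) (identityˡ t))

  length-partialSums : ∀ ts → length (partialSums ts) ≡ length ts
  length-partialSums []       = refl
  length-partialSums (t ∷ ts) = go (0# ⊕ t) ts
    where
    go : ∀ a us → length (scanl _⊕_ a us) ≡ suc (length us)
    go a []       = refl
    go a (u ∷ us) = cong suc (go (a ⊕ u) us)

  -- `z` stands for the vertex that `rotate` moves to the end. It is kept arbitrary because the
  -- starting point moves along the induction while that vertex stays fixed.
  zip-scanl : ∀ a ts z →
    zip (scanl _⊕_ a ts) (drop 1 (scanl _⊕_ a ts) ∷ʳ z) ≡ arcs a ts ∷ʳ (a ⊕ sum ts , z)
  zip-scanl a []       z = cong (λ b → [ (b , z) ]) (sym (⊕-identityʳ a))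
  zip-scanl a (t ∷ ts) z = begin
    zip (a ∷ S) (S ∷ʳ z)                              ≡⟨⟩
    (a , a ⊕ t) ∷ zip S (drop 1 S ∷ʳ z)               ≡⟨ cong (_ ∷_) (zip-scanl (a ⊕ t) ts z) ⟩
    arcs a (t ∷ ts) ∷ʳ (a ⊕ t ⊕ sum ts , z)
      ≡⟨ cong (λ b → arcs a (t ∷ ts) ∷ʳ (b , z)) (⊕-assoc a t (sum ts)) ⟩
    arcs a (t ∷ ts) ∷ʳ (a ⊕ sum (t ∷ ts) , z)         ∎
    where
    S : List (Fin v)
    S = scanl _⊕_ (a ⊕ t) ts

  -- The first partial sum is t₁, not 0, so the closed walk is listed from its second vertex on.
  steps≡rotate-arcs : ∀ g ts → sum ts ≡ 0# → let c = map (g ⊕_) (partialSums ts) in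
                      zip c (rotate c) ≡ rotate (arcs g ts)
  steps≡rotate-arcs g []       _   = refl
  steps≡rotate-arcs g (t ∷ ts) Σ≡0 = begin
    zip c (rotate c)
      ≡⟨ cong (λ l → zip l (rotate l)) (map-partialSums-∷ g t ts) ⟩
    zip S (rotate S)
      ≡⟨⟩
    zip S (drop 1 S ∷ʳ (g ⊕ t))
      ≡⟨ zip-scanl (g ⊕ t) ts (g ⊕ t) ⟩
    arcs (g ⊕ t) ts ∷ʳ (g ⊕ t ⊕ sum ts , g ⊕ t)
      ≡⟨ cong (λ b → arcs (g ⊕ t) ts ∷ʳ (b , g ⊕ t)) closes ⟩
    arcs (g ⊕ t) ts ∷ʳ (g , g ⊕ t) ∎
    where
    c S : List (Fin v)
    c = map (g ⊕_) (partialSums (t ∷ ts))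
    S = scanl _⊕_ (g ⊕ t) ts
    closes : g ⊕ t ⊕ sum ts ≡ g
    closes = trans (⊕-assoc g t (sum ts)) (trans (cong (g ⊕_) Σ≡0) (⊕-identityʳ g))

  arc-difference : ∀ {a ts x y} → (x , y) ∈ arcs a ts → y ⊝ x ∈ ts
  arc-difference {a} {t ∷ ts} (here refl) = here (xyx⁻¹≈y a t)
  arc-difference {a} {t ∷ ts} (there p)   = there (arc-difference p)

  -- The start `a` is `x` minus all increments that precede `d`; the recursion subtracts one for
  -- each increment passed over.
  arc-through : ∀ {d ts} x → d ∈ ts → ∃[ a ] (x , x ⊕ d) ∈ arcs a ts
  arc-through x (here refl)          = x , here refl
  arc-through {d} {t ∷ ts} x (there d∈) with a , p ← arc-through x d∈ =
    a ⊝ t , there (subst (λ b → (x , x ⊕ d) ∈ arcs b ts) (sym ([x⊝y]⊕y≡x a t)) p)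

  -- Since the increments are distinct, the difference of an arc tells its place in the walk. Both
  -- `x ⊝ a` and `x′ ⊝ a′` are then the sum of the increments before that place; the equation is
  -- stated without subtraction. For a common arc it identifies the starts, for a common start it
  -- identifies the arcs.
  arc-position : ∀ {ts a a′ x y x′ y′} → Unique ts →
    (x , y) ∈ arcs a ts → (x′ , y′) ∈ arcs a′ ts → y ⊝ x ≡ y′ ⊝ x′ → x ⊕ a′ ≡ x′ ⊕ a
  arc-position {t ∷ ts} {a} {a′} _ (here refl) (here refl) _ = ⊕-comm a a′
  arc-position {t ∷ ts} {a} (t∉ ∷ _) (here refl) (there q) eq =
    contradiction (trans (sym (xyx⁻¹≈y a t)) eq) (All.lookup t∉ (arc-difference q))
  arc-position {t ∷ ts} {a′ = a′} (t∉ ∷ _) (there p) (here refl) eq =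
    contradiction (trans (sym (xyx⁻¹≈y a′ t)) (sym eq)) (All.lookup t∉ (arc-difference p))
  arc-position {t ∷ ts} {a} {a′} {x} {_} {x′} (_ ∷ u) (there p) (there q) eq =
    ∙-cancelʳ t _ _ (begin
      x ⊕ a′ ⊕ t    ≡⟨ ⊕-assoc x a′ t ⟩
      x ⊕ (a′ ⊕ t)  ≡⟨ arc-position u p q eq ⟩
      x′ ⊕ (a ⊕ t)  ≡⟨ ⊕-assoc x′ a t ⟨
      x′ ⊕ a ⊕ t    ∎)

-- Cycles and their translates

module _ {V : Set} where

  steps : List V → List (V × V)
  steps c = zip c (rotate c)

  consecutiveSubgraph : (c : List V) → (∀ {x} → (x , x) ∉ steps c) → Subgraph V
  consecutiveSubgraph c irr = record
    { Vert      = _∈ c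
    ; Edge      = λ x y → (x , y) ∈ steps c ⊎ (y , x) ∈ steps c
    ; symm      = Sum.swap
    ; irrefl    = Sum.[ irr , irr ]
    ; edge⇒vert = Sum.[ proj₁ ∘ ∈-zip⁻ c (rotate c) , ∈-rotate⁻ c ∘ proj₂ ∘ ∈-zip⁻ c (rotate c) ]
    }

  consecutiveSubgraph-consecutive : ∀ c (irr : ∀ {x} → (x , x) ∉ steps c) →
    consecutiveSubgraph c irr HasConsecutiveVertices c
  consecutiveSubgraph-consecutive c irr = (λ _ → mk⇔ id id) , (λ _ _ → mk⇔ id id)

  consecutive⇒≈ : ∀ {B B′ : Subgraph V} {c} →
    B HasConsecutiveVertices c → B′ HasConsecutiveVertices c → B ≈ B′
  consecutive⇒≈ (vert , edge) (vert′ , edge′) =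
    (λ x → mk⇔ (⇐ (vert′ x) ∘ ⇒ (vert x)) (⇐ (vert x) ∘ ⇒ (vert′ x))) ,
    (λ x y → mk⇔ (⇐ (edge′ x y) ∘ ⇒ (edge x y)) (⇐ (edge x y) ∘ ⇒ (edge′ x y)))

  module _ (σ : V ↔ V) where
    open Inverse σ

    ∈-map-to⁺ : ∀ {x c} → from x ∈ c → x ∈ map to c
    ∈-map-to⁺ {x} {c} x∈ = subst (_∈ map to c) (strictlyInverseˡ x) (∈-map⁺ to x∈)

    ∈-map-to⁻ : ∀ {x c} → x ∈ map to c → from x ∈ c
    ∈-map-to⁻ {x} {c} x∈ with y , y∈ , refl ← ∈-map⁻ to x∈ =
      subst (_∈ c) (sym (strictlyInverseʳ y)) y∈

    steps-map : ∀ c → steps (map to c) ≡ map (Product.map to to) (steps c)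
    steps-map c = begin
      zip (map to c) (rotate (map to c))     ≡⟨ cong (zip (map to c)) (map-rotate to c) ⟨
      zip (map to c) (map to (rotate c))     ≡⟨ zipWith-map _,_ to to c (rotate c) ⟩
      _                                      ≡⟨ map-zipWith _,_ (Product.map to to) c (rotate c) ⟨
      map (Product.map to to) (steps c)      ∎
      where open ≡-Reasoning

    ∈-steps-map⁺ : ∀ {x y c} → (from x , from y) ∈ steps c → (x , y) ∈ steps (map to c)
    ∈-steps-map⁺ {x} {y} {c} p = subst₂ (λ s e → e ∈ s) (sym (steps-map c))
      (cong₂ _,_ (strictlyInverseˡ x) (strictlyInverseˡ y)) (∈-map⁺ (Product.map to to) p)

    ∈-steps-map⁻ : ∀ {x y c} → (x , y) ∈ steps (map to c) → (from x , from y) ∈ steps c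
    ∈-steps-map⁻ {x} {y} {c} p
      with (a , b) , q , refl ← ∈-map⁻ (Product.map to to) (subst ((x , y) ∈_) (steps-map c) p) =
      subst (_∈ steps c) (sym (cong₂ _,_ (strictlyInverseʳ a) (strictlyInverseʳ b))) q

    image-consecutive⁺ : ∀ {B c} → B HasConsecutiveVertices c →
                         image σ B HasConsecutiveVertices map to c
    image-consecutive⁺ (vert , edge) =
      (λ x → mk⇔ (∈-map-to⁺ ∘ ⇒ (vert (from x))) (⇐ (vert (from x)) ∘ ∈-map-to⁻)) ,
      (λ x y → mk⇔ (Sum.map ∈-steps-map⁺ ∈-steps-map⁺ ∘ ⇒ (edge (from x) (from y)))
                   (⇐ (edge (from x) (from y)) ∘ Sum.map ∈-steps-map⁻ ∈-steps-map⁻))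

    -- The converse that the equivalence in `IsAutomorphism` calls for. The hypothesis is evaluated
    -- at `to x` and `to y`, where `from` undoes `to`.
    image-consecutive⁻ : ∀ {B c} → image σ B HasConsecutiveVertices map to c →
                         B HasConsecutiveVertices c
    image-consecutive⁻ {B} {c} (vert , edge) =
      (λ x → mk⇔ (λ p → subst (_∈ c) (strictlyInverseʳ x)
                     (∈-map-to⁻ (⇒ (vert (to x)) (subst (Vert B) (sym (strictlyInverseʳ x)) p))))
                 (λ p → subst (Vert B) (strictlyInverseʳ x) (⇐ (vert (to x)) (∈-map⁺ to p)))) ,
      (λ x y → mk⇔
        (λ p → Sum.map (back x y) (back y x)
          (⇒ (edge (to x) (to y))
             (subst₂ (Edge B) (sym (strictlyInverseʳ x)) (sym (strictlyInverseʳ y)) p)))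
        (λ p → subst₂ (Edge B) (strictlyInverseʳ x) (strictlyInverseʳ y)
          (⇐ (edge (to x) (to y)) (Sum.map forth forth p))))
      where
      forth : ∀ {x y} → (x , y) ∈ steps c → (to x , to y) ∈ steps (map to c)
      forth p = subst (_ ∈_) (sym (steps-map c)) (∈-map⁺ (Product.map to to) p)

      back : ∀ x y → (to x , to y) ∈ steps (map to c) → (x , y) ∈ steps c
      back x y p = subst (_∈ steps c) (cong₂ _,_ (strictlyInverseʳ x) (strictlyInverseʳ y))
        (∈-steps-map⁻ p)

-- Translations of ℤ_v and cycle sets given by differences

module _ {v : ℕ} .{{_ : NonZero v}} where
  open ℤ/-Properties v

  shift : Fin v → Fin v ↔ Fin v
  shift a = mk↔ₛ′ (a ⊕_) (⊖ a ⊕_) (\\-leftDividesˡ a) (\\-leftDividesʳ a)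

  -- Iterates of a translation are translations, so the value at `0#` determines them.
  iterate-⊕ : ∀ a x n → iterate (a ⊕_) x n ≡ iterate (a ⊕_) 0# n ⊕ x
  iterate-⊕ a x zero    = sym (identityˡ x)
  iterate-⊕ a x (suc n) = begin
    iterate (a ⊕_) (a ⊕ x) n               ≡⟨ iterate-⊕ a (a ⊕ x) n ⟩
    p ⊕ (a ⊕ x)                            ≡⟨ ⊕-assoc p a x ⟨
    -- The added `0#` lets the induction hypothesis be read backwards, with `a ⊕ 0#` as the point
    -- iterated from.
    p ⊕ a ⊕ x                              ≡⟨ cong (λ b → p ⊕ b ⊕ x) (⊕-identityʳ a) ⟨
    p ⊕ (a ⊕ 0#) ⊕ x                       ≡⟨ cong (_⊕ x) (iterate-⊕ a (a ⊕ 0#) n) ⟨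
    iterate (a ⊕_) (a ⊕ 0#) n ⊕ x          ∎
    where
    open ≡-Reasoning
    p : Fin v
    p = iterate (a ⊕_) 0# n

  power-shift : ∀ a i x → power (shift a) i x ≡ power (shift a) i 0# ⊕ x
  power-shift a (ℤ.+ n)    x = iterate-⊕ a x n
  power-shift a ℤ.-[1+ n ] x = iterate-⊕ (⊖ a) x (suc n)

  iterate-1 : ∀ x n → iterate (1 mod v ⊕_) x n ≡ n mod v ⊕ x
  iterate-1 x zero    = sym (identityˡ x)
  iterate-1 x (suc n) = begin
    iterate (1 mod v ⊕_) (1 mod v ⊕ x) n  ≡⟨ iterate-1 (1 mod v ⊕ x) n ⟩
    n mod v ⊕ (1 mod v ⊕ x)               ≡⟨ ⊕-assoc (n mod v) (1 mod v) x ⟨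
    n mod v ⊕ 1 mod v ⊕ x                 ≡⟨ cong (_⊕ x) (mod-homo-+ n 1) ⟨
    (n + 1) mod v ⊕ x                     ≡⟨ cong (λ k → k mod v ⊕ x) (ℕ.+-comm n 1) ⟩
    suc n mod v ⊕ x                       ∎
    where open ≡-Reasoning

  -- The exponent is `y ⊝ x` read as a natural number. For uniqueness, every power is translation by
  -- its value at `0#`; cancelling `x` shows that two powers agreeing at `x` translate by the same
  -- amount.
  shift-1-sharplyTransitive : GeneratesSharplyTransitive (shift (1 mod v))
  shift-1-sharplyTransitive x y = ℤ.+ toℕ (y ⊝ x) , reaches , unique
    where
    open ≡-Reasoning
    σ = shift (1 mod v)

    reaches : power σ (ℤ.+ toℕ (y ⊝ x)) x ≡ y
    reaches = begin
      iterate (1 mod v ⊕_) x (toℕ (y ⊝ x))  ≡⟨ iterate-1 x (toℕ (y ⊝ x)) ⟩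
      toℕ (y ⊝ x) mod v ⊕ x                 ≡⟨ cong (_⊕ x) (mod-toℕ (y ⊝ x)) ⟩
      y ⊝ x ⊕ x                             ≡⟨ [x⊝y]⊕y≡x y x ⟩
      y                                     ∎

    unique : ∀ j → power σ j x ≡ y → ∀ z → power σ j z ≡ power σ (ℤ.+ toℕ (y ⊝ x)) z
    unique j eq z = begin
      power σ j z          ≡⟨ power-shift _ j z ⟩
      power σ j 0# ⊕ z     ≡⟨ cong (_⊕ z) (∙-cancelʳ x _ _ (begin
        power σ j 0# ⊕ x     ≡⟨ power-shift _ j x ⟨
        power σ j x          ≡⟨ eq ⟩
        y                    ≡⟨ reaches ⟨
        power σ i x          ≡⟨ power-shift _ i x ⟩
        power σ i 0# ⊕ x     ∎)) ⟩
      power σ i 0# ⊕ z     ≡⟨ power-shift _ i z ⟨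
      power σ i z          ∎
      where i = ℤ.+ toℕ (y ⊝ x)

  -- Translation by `a` carries a cycle based at `g` to one based at `a ⊕ g`; conversely, an image
  -- based at `g` comes from a cycle based at `⊖ a ⊕ g`.
  cyclesOf-shift : ∀ {m} (ω : Fin m → List (Fin v)) a → IsAutomorphism (shift a) (cyclesOf ω)
  cyclesOf-shift ω a B = mk⇔
    (λ (i , g , con) → i , a ⊕ g ,
      subst (image (shift a) B HasConsecutiveVertices_) (translate g i)
        (image-consecutive⁺ (shift a) {B} con))
    (λ (i , g , con) → i , ⊖ a ⊕ g ,
      image-consecutive⁻ (shift a) {B}
        (subst (image (shift a) B HasConsecutiveVertices_)
          (trans (cong (λ h → map (h ⊕_) (partialSums (ω i))) (sym (\\-leftDividesˡ a g)))
                 (sym (translate (⊖ a ⊕ g) i)))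
          con))
    where
    translate : ∀ g i → map (a ⊕_) (map (g ⊕_) (partialSums (ω i))) ≡
                        map (a ⊕ g ⊕_) (partialSums (ω i))
    translate g i = trans (sym (map-∘ (partialSums (ω i))))
                          (map-cong (λ x → sym (⊕-assoc a g x)) (partialSums (ω i)))

  cyclesOf-isCyclic : ∀ {m} (ω : Fin m → List (Fin v)) → IsCyclic (cyclesOf ω)
  cyclesOf-isCyclic ω = shift (1 mod v) , cyclesOf-shift ω (1 mod v) , shift-1-sharplyTransitive

  -- Isolates what row orderings and column orderings have in common, so that one argument yields
  -- both decompositions. It is a relative difference family in terms of increments: up to sign,
  -- every element outside `J` occurs exactly once among all the lists.
  record DifferenceSystem (J : Subset v) {m : ℕ} (ω : Fin m → List (Fin v)) : Set where
    field
      zero-sum     : ∀ i → sum (ω i) ≡ 0#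
      simple       : ∀ i → SimpleOrdering (ω i)
      distinct     : ∀ i → Unique (ω i)
      disjoint     : ∀ {d i j} → d ∈ ω i → d ∈ ω j → i ≡ j
      no-opposites : ∀ {d i j} → d ∈ ω i → ⊖ d ∉ ω j
      avoids       : ∀ {d i} → d ∈ ω i → d ∉ₛ J
      covers       : ∀ {d} → d ∉ₛ J → ∃[ i ] (d ∈ ω i ⊎ ⊖ d ∈ ω i)

  coset-difference : ∀ z j j′ → z ⊕ j′ ⊝ (z ⊕ j) ≡ j′ ⊝ j
  coset-difference z j j′ = begin
    z ⊕ j′ ⊕ ⊖ (z ⊕ j)          ≡⟨ cong (z ⊕ j′ ⊕_) (⁻¹-∙-comm z j) ⟨
    z ⊕ j′ ⊕ (⊖ z ⊕ ⊖ j)        ≡⟨ interchange z j′ (⊖ z) (⊖ j) ⟩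
    z ⊕ ⊖ z ⊕ (j′ ⊕ ⊖ j)        ≡⟨ cong (_⊕ (j′ ⊕ ⊖ j)) (⊕-inverseʳ z) ⟩
    0# ⊕ (j′ ⊕ ⊖ j)             ≡⟨ identityˡ _ ⟩
    j′ ⊝ j                      ∎
    where open ≡-Reasoning

  -- A cycle on at most two steps would need the difference 0 or two opposite differences.
  3≤length : ∀ ts → length ts ≢ 0 → sum ts ≡ 0# → 0# ∉ ts → (∀ {d} → d ∈ ts → ⊖ d ∉ ts) →
             3 ≤ length ts
  3≤length []              ≢0 _   _   _   = contradiction refl ≢0
  3≤length (t ∷ [])        _  Σ≡0 0∉  _   =
    contradiction (here (trans (sym Σ≡0) (⊕-identityʳ t))) 0∉
  3≤length (t ∷ u ∷ [])    _  Σ≡0 _   opp =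
    contradiction (there (here (sym (inverseʳ-unique t u
                     (trans (cong (t ⊕_) (sym (⊕-identityʳ u))) Σ≡0)))))
                  (opp (here refl))
  3≤length (_ ∷ _ ∷ _ ∷ _) _  _   _   _   = s≤s (s≤s (s≤s z≤n))

  arc⇒step : ∀ {g ts} → sum ts ≡ 0# → ∀ {a} → a ∈ arcs g ts → a ∈ steps (map (g ⊕_) (partialSums ts))
  arc⇒step {g} {ts} Σ≡0 p = subst (_ ∈_) (sym (steps≡rotate-arcs g ts Σ≡0)) (∈-rotate⁺ (arcs g ts) p)

  step⇒arc : ∀ {g ts} → sum ts ≡ 0# → ∀ {a} → a ∈ steps (map (g ⊕_) (partialSums ts)) → a ∈ arcs g ts
  step⇒arc {g} {ts} Σ≡0 p = ∈-rotate⁻ (arcs g ts) (subst (_ ∈_) (steps≡rotate-arcs g ts Σ≡0) p)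

  edge⇒arc : ∀ {B g ts} → sum ts ≡ 0# → B HasConsecutiveVertices map (g ⊕_) (partialSums ts) →
             ∀ {x y} → Edge B x y → (x , y) ∈ arcs g ts ⊎ (y , x) ∈ arcs g ts
  edge⇒arc {B} Σ≡0 (_ , edge) e = Sum.map (step⇒arc Σ≡0) (step⇒arc Σ≡0) (⇒ (edge _ _) e)

  -- Traversing an edge backwards negates its difference. A shared edge with opposite orientations
  -- in the two walks would give some `d` in `ts` with `⊖ d` in `ts′`.
  common-arc : ∀ {B B′ g g′ ts ts′} → sum ts ≡ 0# → sum ts′ ≡ 0# → (∀ {d} → d ∈ ts → ⊖ d ∉ ts′) →
    B HasConsecutiveVertices map (g ⊕_) (partialSums ts) →
    B′ HasConsecutiveVertices map (g′ ⊕_) (partialSums ts′) →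
    ∀ {x y} → Edge B x y → Edge B′ x y →
    ((x , y) ∈ arcs g ts × (x , y) ∈ arcs g′ ts′) ⊎ ((y , x) ∈ arcs g ts × (y , x) ∈ arcs g′ ts′)
  common-arc {B} {B′} {ts′ = ts′} Σ Σ′ opp con con′ {x} {y} e e′
    with edge⇒arc {B} Σ con e | edge⇒arc {B′} Σ′ con′ e′
  ... | inj₁ p | inj₁ q = inj₁ (p , q)
  ... | inj₂ p | inj₂ q = inj₂ (p , q)
  ... | inj₁ p | inj₂ q = contradiction
    (subst (_∈ ts′) (sym (⁻¹-anti-homo‿- y x)) (arc-difference q)) (opp (arc-difference p))
  ... | inj₂ p | inj₁ q = contradiction
    (subst (_∈ ts′) (sym (⁻¹-anti-homo‿- x y)) (arc-difference q)) (opp (arc-difference p))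

  module _ {J : Subset v} (J-sub : IsSubgroup J) where
    open IsSubgroup J-sub

    module _ {m : ℕ} {ω : Fin m → List (Fin v)} (system : DifferenceSystem J ω) where
      open DifferenceSystem system

      0∉ω : ∀ {i} → 0# ∉ ω i
      0∉ω 0∈ω = avoids 0∈ω 0-closed

      cycle-through : ∀ {i d} x → d ∈ ω i → ∃[ B ] cyclesOf ω B × Edge B x (x ⊕ d)
      cycle-through {i} {d} x d∈ω with g , p ← arc-through x d∈ω =
        consecutiveSubgraph c no-loop ,
        (i , g , consecutiveSubgraph-consecutive c no-loop) ,
        inj₁ (arc⇒step (zero-sum i) p)
        where
        c : List (Fin v)
        c = map (g ⊕_) (partialSums (ω i))

        no-loop : ∀ {y} → (y , y) ∉ steps c
        no-loop {y} q =
          0∉ω (subst (_∈ ω i) (⊕-inverseʳ y) (arc-difference (step⇒arc (zero-sum i) q)))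

      -- Two elements of one coset differ by an element of `J`, whereas the difference along an arc
      -- is an increment and so lies outside `J`.
      separated : ∀ {i g x y z} → (x , y) ∈ arcs g (ω i) →
                  x ∈coset z + J → y ∈coset z + J → ⊥
      separated {z = z} p (j , j∈J , refl) (j′ , j′∈J , refl) =
        avoids (arc-difference p)
          (subst (_∈ₛ J) (sym (coset-difference z j j′)) (⊕-closed j′∈J (⊖-closed j∈J)))

      cyclesOf-⊑ : ∀ {B} → cyclesOf ω B → B ⊑ cosetGraph J J-sub
      cyclesOf-⊑ {B} (i , g , con) e (z , x∈ , y∈) with edge⇒arc {B} (zero-sum i) con e
      ... | inj₁ p = separated p x∈ y∈
      ... | inj₂ p = separated p y∈ x∈

      cyclesOf-cycles : ∀ {ℓ} .{{_ : NonZero ℓ}} → (∀ i → length (ω i) ≡ ℓ) →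
                        ∀ {B} → cyclesOf ω B → IsCycle ℓ B
      cyclesOf-cycles {ℓ} lengths (i , g , con) =
        subst (3 ≤_) (lengths i)
          -- A nonzero `ℓ` excludes the empty list, whose sum is zero and which has no forbidden
          -- increments.
          (3≤length (ω i) (λ eq → ≢-nonZero⁻¹ ℓ (trans (sym (lengths i)) eq))
                    (zero-sum i) 0∉ω no-opposites) ,
        map (g ⊕_) (partialSums (ω i)) ,
        trans (length-map (g ⊕_) (partialSums (ω i)))
              (trans (length-partialSums (ω i)) (lengths i)) ,
        Unique.map⁺ (∙-cancelˡ g _ _) (simple i) ,
        con

      cycle-through-edge : ∀ x y {i} → y ⊝ x ∈ ω i ⊎ ⊖ (y ⊝ x) ∈ ω i →
                           ∃[ B ] cyclesOf ω B × Edge B x y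
      cycle-through-edge x y (inj₁ d∈) =
        let B , D , e = cycle-through x d∈
        in B , D , subst (Edge B x) (x⊕[y⊝x]≡y x y) e
      -- Here it is `x ⊝ y` that occurs as an increment, so the arc runs from `y` to `x`.
      cycle-through-edge x y {i} (inj₂ -d∈) =
        let B , D , e = cycle-through y (subst (_∈ ω i) (⁻¹-anti-homo‿- y x) -d∈)
        in B , D , symm B (subst (Edge B y) (x⊕[y⊝x]≡y y x) e)

      cyclesOf-covering : ∀ {x y} → Graph.Adj (cosetGraph J J-sub) x y →
                          ∃[ B ] cyclesOf ω B × Edge B x y
      -- If `y ⊝ x` were in `J`, both vertices would lie in the coset of `x`.
      cyclesOf-covering {x} {y} adj = cycle-through-edge x y (proj₂ (covers {y ⊝ x} λ d∈J →
        adj (x , (0# , 0-closed , sym (⊕-identityʳ x)) , (y ⊝ x , d∈J , sym (x⊕[y⊝x]≡y x y)))))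

      cyclesOf-disjoint : ∀ {B B′ x y} → cyclesOf ω B → cyclesOf ω B′ →
                          Edge B x y → Edge B′ x y → B ≈ B′
      cyclesOf-disjoint {B} {B′} (i , g , con) (i′ , g′ , con′) e e′ =
        Sum.[ agree , agree ]
          (common-arc {B} {B′} (zero-sum i) (zero-sum i′) no-opposites con con′ e e′)
        where
        agree : ∀ {a b} → (a , b) ∈ arcs g (ω i) × (a , b) ∈ arcs g′ (ω i′) → B ≈ B′
        agree {a} (p , q)
          -- The difference of the common arc occurs in one list only, which identifies `i` and
          -- `i′`; its place in that list then fixes the start, so `g` and `g′` agree and both
          -- subgraphs follow the same vertex list.
          with refl ← disjoint (arc-difference p) (arc-difference q)
          with refl ← ∙-cancelˡ a g′ g (arc-position (distinct i) p q refl) =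
          consecutive⇒≈ {B = B} {B′} con con′

      cyclesOf-isCycleDecomposition : ∀ {ℓ} .{{_ : NonZero ℓ}} → (∀ i → length (ω i) ≡ ℓ) →
        IsCycleDecomposition ℓ (cosetGraph J J-sub) (cyclesOf ω)
      cyclesOf-isCycleDecomposition lengths = record
        { subgraphs = λ {B} → cyclesOf-⊑ {B}
        ; cycles    = λ {B} → cyclesOf-cycles lengths {B}
        ; covering  = cyclesOf-covering
        ; disjoint  = λ {B} {B′} → cyclesOf-disjoint {B} {B′}
        }

  -- By `opp` a common edge has the same orientation in both walks, so its difference lies in both
  -- lists. By `meet` there is only one such difference, and the walk of the first system has only
  -- one arc with it.
  cyclesOf-orthogonal : ∀ {J : Subset v} {m n} {ω : Fin m → List (Fin v)} {ω′ : Fin n → List (Fin v)} →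
    DifferenceSystem J ω → DifferenceSystem J ω′ →
    (∀ {d i j} → d ∈ ω i → ⊖ d ∉ ω′ j) →
    (∀ {d d′ i j} → d ∈ ω i → d ∈ ω′ j → d′ ∈ ω i → d′ ∈ ω′ j → d ≡ d′) →
    Orthogonal (cyclesOf ω) (cyclesOf ω′)
  cyclesOf-orthogonal {ω = ω} {ω′} S S′ opp meet {B} {B′} (i , g , con) (j , g′ , con′) e₁ e₁′ e₂ e₂′ =
    -- Edges are unordered and arcs are not: if the two arcs run differently relative to the named
    -- endpoints, the edges agree after a swap.
    Sum.[ (λ p → Sum.[ (λ q → inj₁ (same-arc p q))
                     , (λ q → inj₂ (same-arc p q)) ] arc₂)
        , (λ p → Sum.[ (λ q → inj₂ (Product.swap (same-arc p q)))
                     , (λ q → inj₁ (Product.swap (same-arc p q))) ] arc₂)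
        ] arc₁
    where
    module S = DifferenceSystem S
    module S′ = DifferenceSystem S′
    arc₁ = common-arc {B} {B′} (S.zero-sum i) (S′.zero-sum j) opp con con′ e₁ e₁′
    arc₂ = common-arc {B} {B′} (S.zero-sum i) (S′.zero-sum j) opp con con′ e₂ e₂′

    same-arc : ∀ {a b a′ b′} →
      (a , b) ∈ arcs g (ω i) × (a , b) ∈ arcs g′ (ω′ j) →
      (a′ , b′) ∈ arcs g (ω i) × (a′ , b′) ∈ arcs g′ (ω′ j) →
      a ≡ a′ × b ≡ b′
    same-arc {a} {b} {a′} {b′} (p , p′) (q , q′) = a≡a′ , (begin
      b              ≡⟨ x⊕[y⊝x]≡y a b ⟨
      a ⊕ (b ⊝ a)    ≡⟨ cong₂ _⊕_ a≡a′ same-difference ⟩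
      a′ ⊕ (b′ ⊝ a′) ≡⟨ x⊕[y⊝x]≡y a′ b′ ⟩
      b′             ∎)
      where
      open ≡-Reasoning
      same-difference : b ⊝ a ≡ b′ ⊝ a′
      same-difference = meet (arc-difference p) (arc-difference p′) (arc-difference q) (arc-difference q′)

      a≡a′ : a ≡ a′
      -- Both arcs belong to the walk from `g`, so `g` is the start on either side and cancels.
      a≡a′ = ∙-cancelʳ g a a′ (arc-position (S.distinct i) p q same-difference)

-- Heffter arrays

module _ {v : ℕ} .{{_ : NonZero v}} where
  open ℤ/-Properties v

  signed : List (Fin v) → List (Fin v)
  signed xs = xs ++ map ⊖_ xs

  signed-↭ : ∀ {xs ys} → xs ↭ ys → signed xs ↭ signed ys
  signed-↭ p = Perm.++⁺ p (Perm.map⁺ ⊖_ p)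

  module _ {J : Subset v} where

    module _ {M : List (Fin v)} (M↭ : signed M ↭ elements (∁ J)) where

      private
        split : Unique M × Unique (map ⊖_ M) × Disjoint M (map ⊖_ M)
        split = Unique-++⁻ M (Unique-resp-↭ (↭-sym M↭) (elements-unique (∁ J)))

      signed-unique⁻ : Unique M
      signed-unique⁻ = proj₁ split

      -- Opposite entries would put `⊖ d` both in `M` and among the negatives, a repetition in a
      -- list that enumerates the complement of `J` once. This also excludes `d ≡ ⊖ d`.
      signed-no-opposites : ∀ {d} → d ∈ M → ⊖ d ∉ M
      signed-no-opposites d∈ -d∈ = proj₂ (proj₂ split) (-d∈ , ∈-map⁺ ⊖_ d∈)

      signed-outside : ∀ {d} → d ∈ M → d ∉ₛ J
      signed-outside d∈ = x∈∁p⇒x∉p (∈-elements⁻ (∁ J) (Perm.∈-resp-↭ M↭ (∈-++⁺ˡ d∈)))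

      signed-covers : ∀ {d} → d ∉ₛ J → d ∈ M ⊎ ⊖ d ∈ M
      signed-covers d∉ with ∈-++⁻ M (Perm.∈-resp-↭ (↭-sym M↭) (∈-elements⁺ (x∉p⇒x∈∁p d∉)))
      ... | inj₁ d∈  = inj₁ d∈
      ... | inj₂ -d∈ with e , e∈ , refl ← ∈-map⁻ ⊖_ -d∈ =
        inj₂ (subst (_∈ M) (sym (⁻¹-involutive e)) e∈)

    signed-differenceSystem : ∀ {m} {ω : Fin m → List (Fin v)} →
      signed (concat (tabulate ω)) ↭ elements (∁ J) →
      (∀ i → sum (ω i) ≡ 0#) → (∀ i → SimpleOrdering (ω i)) → DifferenceSystem J ω
    signed-differenceSystem {ω = ω} M↭ Σ≡0 simple = record
      { zero-sum     = Σ≡0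
      ; simple       = simple
      ; distinct     = concat-tabulate-unique⁻ ω (signed-unique⁻ M↭)
      ; disjoint     = concat-tabulate-disjoint⁻ ω (signed-unique⁻ M↭)
      ; no-opposites = λ d∈ -d∈ → signed-no-opposites M↭ (∈M d∈) (∈M -d∈)
      ; avoids       = λ d∈ → signed-outside M↭ (∈M d∈)
      ; covers       = covers
      }
      where
      ∈M : ∀ {i d} → d ∈ ω i → d ∈ concat (tabulate ω)
      ∈M = ∈-concat-tabulate⁺ ω _

      covers : ∀ {d} → d ∉ₛ J → ∃[ i ] (d ∈ ω i ⊎ ⊖ d ∈ ω i)
      covers d∉ with signed-covers M↭ d∉
      ... | inj₁ d∈  = let i , p = ∈-concat-tabulate⁻ ω d∈ in i , inj₁ p
      ... | inj₂ -d∈ = let i , p = ∈-concat-tabulate⁻ ω -d∈ in i , inj₂ p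

    -- `covers` gives an inclusion of the complement in the signed entries, and both lists have
    -- length `2 * n * k`. Repetition is excluded beforehand only on the side of the complement, so
    -- `unique-⊆⇒↭` is applied from there and then reversed.
    heffter-signed : ∀ {m n s k t} → v ≡ 2 * n * k + t → ∣ J ∣ ≡ t →
      {A : PFArray (Fin v) m n} → IsHeffter J s k A →
      signed (concat (tabulate (column A))) ↭ elements (∁ J)
    heffter-signed {n = n} {k = k} {t} v≡ ∣J∣≡t {A} heffter =
      ↭-sym (unique-⊆⇒↭ (elements-unique (∁ J)) complement⊆ (ℕ.≤-reflexive lengths))
      where
      open IsHeffter heffter
      M : List (Fin v)
      M = concat (tabulate (column A))

      appears⇒∈ : ∀ {x} → Appears x A → x ∈ M
      appears⇒∈ (i , j , eq) =
        ∈-concat-tabulate⁺ (column A) j (∈-catMaybes-tabulate⁺ (λ i → A i j) i eq)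

      complement⊆ : elements (∁ J) ⊆ signed M
      complement⊆ {x} x∈ with covers x (x∈∁p⇒x∉p (∈-elements⁻ (∁ J) x∈))
      ... | inj₁ a = ∈-++⁺ˡ (appears⇒∈ a)
      ... | inj₂ a = ∈-++⁺ʳ M (subst (_∈ map ⊖_ M) (⁻¹-involutive x) (∈-map⁺ ⊖_ (appears⇒∈ a)))

      length-M : length M ≡ n * k
      length-M = length-concat-tabulate (column A) column-filled

      lengths : length (signed M) ≡ length (elements (∁ J))
      lengths = begin
        length (signed M)                ≡⟨ length-++ M ⟩
        length M + length (map ⊖_ M)     ≡⟨ cong (length M +_) (length-map ⊖_ M) ⟩
        length M + length M              ≡⟨ cong₂ _+_ length-M length-M ⟩
        n * k + n * k                    ≡⟨ cong (n * k +_) (ℕ.+-identityʳ (n * k)) ⟨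
        2 * (n * k)                      ≡⟨ ℕ.*-assoc 2 n k ⟨
        2 * n * k                        ≡⟨ ℕ.m+n∸n≡m (2 * n * k) t ⟨
        2 * n * k + t ∸ t                ≡⟨ cong₂ _∸_ v≡ ∣J∣≡t ⟨
        v ∸ ∣ J ∣                        ≡⟨ ∣∁p∣≡n∸∣p∣ J ⟨
        ∣ ∁ J ∣                          ≡⟨ length-elements (∁ J) ⟨
        length (elements (∁ J))          ∎
        where open ≡-Reasoning

  -- Lagrange's theorem in the form available for abelian groups: translation by `j` permutes `J`,
  -- yet changes the sum of its elements by `∣ J ∣` times `j`.
  ∣J∣*j≡0 : {J : Subset v} → IsSubgroup J → ∀ {j} → j ∈ₛ J → (∣ J ∣ * toℕ j) mod v ≡ 0#
  ∣J∣*j≡0 {J} J-sub {j} j∈J = identityʳ-unique (sum Js) _ (begin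
    sum Js ⊕ (∣ J ∣ * toℕ j) mod v     ≡⟨ cong (λ l → sum Js ⊕ (l * toℕ j) mod v) (length-elements J) ⟨
    sum Js ⊕ (length Js * toℕ j) mod v ≡⟨ sum-map-⊕ j Js ⟨
    sum (map (_⊕ j) Js)                ≡⟨ sum-↭ translate ⟩
    sum Js                             ∎)
    where
    open ≡-Reasoning
    Js : List (Fin v)
    Js = elements J

    translate⊆ : map (_⊕ j) Js ⊆ Js
    translate⊆ x∈ with y , y∈ , refl ← ∈-map⁻ (_⊕ j) x∈ =
      ∈-elements⁺ (IsSubgroup.⊕-closed J-sub (∈-elements⁻ J y∈) j∈J)

    translate : map (_⊕ j) Js ↭ Js
    translate = unique-⊆⇒↭ (Unique.map⁺ (∙-cancelʳ j _ _) (elements-unique J)) translate⊆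
      (ℕ.≤-reflexive (sym (length-map (_⊕ j) Js)))

-- Cosets of `J` as residue classes modulo `q`

module _ {t q : ℕ} .{{_ : NonZero t}} .{{_ : NonZero q}} .{{_ : NonZero (t * q)}} where

  residue : Fin (t * q) → Fin q
  residue x = toℕ x mod q

  residue-combine : ∀ (i : Fin t) (r : Fin q) → residue (combine i r) ≡ r
  residue-combine i r = begin
    toℕ (combine i r) mod q        ≡⟨ cong (_mod q) (toℕ-combine i r) ⟩
    (q * toℕ i + toℕ r) mod q      ≡⟨ cong (_mod q) (ℕ.+-comm (q * toℕ i) (toℕ r)) ⟩
    (toℕ r + q * toℕ i) mod q      ≡⟨ cong (λ a → (toℕ r + a) mod q) (ℕ.*-comm q (toℕ i)) ⟩
    (toℕ r + toℕ i * q) mod q      ≡⟨ mod-cong-% ([m+kn]%n≡m%n (toℕ r) (toℕ i) q) ⟩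
    toℕ r mod q                    ≡⟨ mod-toℕ r ⟩
    r                              ∎
    where open ≡-Reasoning

  -- By `residue-combine` the remainder paired with the quotient is the residue, so quotient and
  -- residue together recover `x`.
  combine-residue : ∀ x → combine (quotient {t} q x) (residue x) ≡ x
  combine-residue x = begin
    combine a (residue x)              ≡⟨ cong (λ y → combine a (residue y)) (combine-remQuot {t} q x) ⟨
    combine a (residue (combine a r))  ≡⟨ cong (combine a) (residue-combine a r) ⟩
    combine a r                        ≡⟨ combine-remQuot {t} q x ⟩
    x                                  ∎
    where
    open ≡-Reasoning
    a : Fin t
    a = quotient {t} q x
    r : Fin q
    r = remainder {t} q x

  residue-⊕ : ∀ x y → residue (x ⊕ y) ≡ residue x ⊕ residue y
  residue-⊕ x y = trans
    (mod-cong-% (trans (cong (_% q) (toℕ-mod (toℕ x + toℕ y)))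
                       -- Reducing modulo `t * q` first does not change the residue, since `q`
                       -- divides `t * q`.
                       (m∣n⇒o%n%m≡o%m q (t * q) (toℕ x + toℕ y) (n∣m*n t))))
    (mod-homo-+ (toℕ x) (toℕ y))

  residue-fibre : ∀ r → Fin t ↔ (∃[ x ] residue x ≡ r)
  residue-fibre r = mk↔ₛ′
    (λ i → combine i r , residue-combine i r)
    (λ (x , _) → quotient {t} q x)
    (λ (x , eq) → ∃-≡ (trans (cong (combine (quotient {t} q x)) (sym eq)) (combine-residue x)))
    (λ i → cong proj₁ (remQuot-combine i r))
    where
    -- Proofs of an equation between residues are unique, so members of a fibre are compared by
    -- their first components.
    ∃-≡ : ∀ {x y} {p : residue x ≡ r} {p′ : residue y ≡ r} → x ≡ y → (x , p) ≡ (y , p′)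
    ∃-≡ {p = refl} {refl} refl = refl

  module _ {J : Subset (t * q)} (J-sub : IsSubgroup J) (∣J∣≡t : ∣ J ∣ ≡ t) where

    ∈⇒residue≡0 : ∀ {j} → j ∈ₛ J → residue j ≡ 0#
    ∈⇒residue≡0 {j} j∈J = mod-cong-% (trans (n∣m⇒m%n≡0 (toℕ j) q q∣j) (sym (m*n%n≡0 0 q)))
      where
      tj%tq≡0 : (t * toℕ j) % (t * q) ≡ 0
      tj%tq≡0 = begin
        (t * toℕ j) % (t * q)               ≡⟨ toℕ-mod (t * toℕ j) ⟨
        toℕ ((t * toℕ j) mod (t * q))       ≡⟨ cong (λ l → toℕ ((l * toℕ j) mod (t * q))) ∣J∣≡t ⟨
        toℕ ((∣ J ∣ * toℕ j) mod (t * q))   ≡⟨ cong toℕ (∣J∣*j≡0 J-sub j∈J) ⟩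
        toℕ (0# {t * q})                    ≡⟨ toℕ-mod 0 ⟩
        0 % (t * q)                         ≡⟨ m*n%n≡0 0 (t * q) ⟩
        0                                   ∎
        where open ≡-Reasoning

      q∣j : q ∣ toℕ j
      q∣j = *-cancelˡ-∣ t (m%n≡0⇒n∣m (t * toℕ j) (t * q) tj%tq≡0)

    -- `J` lies in the kernel of `residue`, which has `t` elements, one for each quotient; equal
    -- size forces equality.
    residue≡0⇒∈ : ∀ {x} → residue x ≡ 0# → x ∈ₛ J
    residue≡0⇒∈ {x} eq = ∈-elements⁻ J (Perm.∈-resp-↭ (↭-sym J↭kernel) (∈kernel eq))
      where
      kernel : List (Fin (t * q))
      kernel = tabulate λ (i : Fin t) → combine i 0#

      ∈kernel : ∀ {y} → residue y ≡ 0# → y ∈ kernel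
      ∈kernel {y} eq = subst (_∈ kernel)
        (trans (cong (combine (quotient {t} q y)) (sym eq)) (combine-residue y))
        (∈-tabulate⁺ (quotient {t} q y))

      J↭kernel : elements J ↭ kernel
      J↭kernel = unique-⊆⇒↭ (elements-unique J) (∈kernel ∘ ∈⇒residue≡0 ∘ ∈-elements⁻ J)
        (ℕ.≤-reflexive (trans (length-tabulate {n = t} (λ i → combine i 0#))
                              (sym (trans (length-elements J) ∣J∣≡t))))

    residue-coset : ∀ {x z} → x ∈coset z + J → residue x ≡ residue z
    residue-coset {z = z} (j , j∈J , refl) = begin
      residue (z ⊕ j)         ≡⟨ residue-⊕ z j ⟩
      residue z ⊕ residue j   ≡⟨ cong (residue z ⊕_) (∈⇒residue≡0 j∈J) ⟩
      residue z ⊕ 0#          ≡⟨ ⊕-identityʳ (residue z) ⟩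
      residue z               ∎
      where open ≡-Reasoning

    residue≡⇒difference∈ : ∀ {x y} → residue x ≡ residue y → y ⊝ x ∈ₛ J
    residue≡⇒difference∈ {x} {y} eq = residue≡0⇒∈ (identityʳ-unique (residue x) _ (begin
      residue x ⊕ residue (y ⊝ x)  ≡⟨ residue-⊕ x (y ⊝ x) ⟨
      residue (x ⊕ (y ⊝ x))        ≡⟨ cong residue (x⊕[y⊝x]≡y x y) ⟩
      residue y                    ≡⟨ eq ⟨
      residue x                    ∎))
      where
      open ≡-Reasoning
      open ℤ/-Properties q

    cosetGraph-isCompleteMultipartite : IsCompleteMultipartite q t (cosetGraph J J-sub)
    cosetGraph-isCompleteMultipartite = record
      { part      = residue
      ; part-size = residue-fibre
      ; adjacent  = λ x y → mk⇔ adjacent⇒ adjacent⇐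
      }
      where
      adjacent⇒ : ∀ {x y} → Graph.Adj (cosetGraph J J-sub) x y → residue x ≢ residue y
      adjacent⇒ {x} {y} adj eq = adj (x , (0# , IsSubgroup.0-closed J-sub , sym (⊕-identityʳ x)) ,
                                          (y ⊝ x , residue≡⇒difference∈ eq , sym (x⊕[y⊝x]≡y x y)))

      adjacent⇐ : ∀ {x y} → residue x ≢ residue y → Graph.Adj (cosetGraph J J-sub) x y
      adjacent⇐ neq (z , x∈ , y∈) = neq (trans (residue-coset x∈) (sym (residue-coset y∈)))

-- Matching on the equation makes the modulus literally `t * q`, the form in which `combine` and
-- `quotient` apply.
cosetGraph-multipartite : ∀ {v t q} .{{_ : NonZero v}} .{{_ : NonZero t}} .{{_ : NonZero q}} →
  v ≡ t * q → {J : Subset v} (J-sub : IsSubgroup J) → ∣ J ∣ ≡ t →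
  IsCompleteMultipartite q t (cosetGraph J J-sub)
cosetGraph-multipartite refl = cosetGraph-isCompleteMultipartite

proposition2p9 : (m n s k t v : ℕ)
    .{{_ : NonZero m}} .{{_ : NonZero n}} .{{_ : NonZero s}} .{{_ : NonZero k}}
    .{{_ : NonZero t}} .{{_ : NonZero v}} →
    v ≡ 2 * n * k + t → t ∣ 2 * n * k →
    (J : Subset v) (J-sub : IsSubgroup J) → ∣ J ∣ ≡ t →
    (A : PFArray (Fin v) m n) → IsHeffter J s k A →
    (ωr : Fin m → List (Fin v)) (ωc : Fin n → List (Fin v)) → IsSimple A ωr ωc →
    let K = cosetGraph J J-sub in
    (IsCompleteMultipartite ((2 * m * s + t) / t) t K
    × IsCyclicCycleDecomposition s K (cyclesOf ωr))
    × (IsCompleteMultipartite ((2 * n * k + t) / t) t K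
    × IsCyclicCycleDecomposition k K (cyclesOf ωc))
    × Orthogonal (cyclesOf ωr) (cyclesOf ωc)
proposition2p9 m n s k t v v≡ t∣2nk J J-sub ∣J∣≡t A heffter ωr ωc simple =
  ( subst (λ e → IsCompleteMultipartite ((e + t) / t) t K) 2nk≡2ms multipartite
  , cyclesOf-isCycleDecomposition J-sub rows
      (λ i → trans (Perm.↭-length (row-ordering i)) (row-filled i))
  , cyclesOf-isCyclic ωr) ,
  ( multipartite
  , cyclesOf-isCycleDecomposition J-sub columns
      (λ j → trans (Perm.↭-length (column-ordering j)) (column-filled j))
  , cyclesOf-isCyclic ωc) ,
  (λ {B} {B′} → cyclesOf-orthogonal rows columns
    (λ d∈ -d∈ → signed-no-opposites {J = J} entries (row∈M d∈) (column∈M -d∈))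
    -- Row `i` and column `j` meet in a single cell, and a cell holds at most one value.
    (λ p q p′ q′ → just-injective (trans (sym (common-cell p q)) (common-cell p′ q′)))
    {B} {B′})
  where
  open IsHeffter heffter
  open IsSimple simple

  K : Graph (Fin v)
  K = cosetGraph J J-sub

  M : List (Fin v)
  M = concat (tabulate (row A))

  -- The count made along columns is moved to the rows, so that row and column entries are compared
  -- inside one list `M`.
  entries : signed M ↭ elements (∁ J)
  entries = ↭-trans (signed-↭ (↭-sym (columns↭rows A))) (heffter-signed v≡ ∣J∣≡t heffter)

  rows : DifferenceSystem J ωr
  rows = signed-differenceSystem
    (↭-trans (signed-↭ (concat-tabulate-cong-↭ row-ordering)) entries)
    (λ i → trans (sum-↭ (row-ordering i)) (row-sum i))
    row-simple

  columns : DifferenceSystem J ωc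
  columns = signed-differenceSystem
    (↭-trans (signed-↭ (concat-tabulate-cong-↭ column-ordering)) (heffter-signed v≡ ∣J∣≡t heffter))
    (λ j → trans (sum-↭ (column-ordering j)) (column-sum j))
    column-simple

  row∈M : ∀ {d i} → d ∈ ωr i → d ∈ M
  row∈M {i = i} d∈ = ∈-concat-tabulate⁺ (row A) i (Perm.∈-resp-↭ (row-ordering i) d∈)

  column∈M : ∀ {d j} → d ∈ ωc j → d ∈ M
  column∈M {j = j} d∈ = Perm.∈-resp-↭ (columns↭rows A)
    (∈-concat-tabulate⁺ (column A) j (Perm.∈-resp-↭ (column-ordering j) d∈))

  -- Membership in column `j` places `d` in some row `i′` of that column; the entries of the whole
  -- array are distinct, so `i′` must be `i`.
  common-cell : ∀ {d i j} → d ∈ ωr i → d ∈ ωc j → A i j ≡ just d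
  common-cell {d} {i} {j} d∈r d∈c
    with i′ , eq ← ∈-catMaybes-tabulate⁻ (λ i → A i j) (Perm.∈-resp-↭ (column-ordering j) d∈c)
    with refl ← concat-tabulate-disjoint⁻ (row A) (signed-unique⁻ {J = J} entries) {i = i} {i′}
                  (Perm.∈-resp-↭ (row-ordering i) d∈r)
                  (∈-catMaybes-tabulate⁺ (A i′) j eq) = eq

  -- Both sides are twice the number of filled cells.
  2nk≡2ms : 2 * n * k ≡ 2 * m * s
  2nk≡2ms = begin
    2 * n * k    ≡⟨ ℕ.*-assoc 2 n k ⟩
    2 * (n * k)  ≡⟨ cong (2 *_) (length-concat-tabulate (column A) column-filled) ⟨
    2 * length (concat (tabulate (column A)))  ≡⟨ cong (2 *_) (Perm.↭-length (columns↭rows A)) ⟩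
    2 * length M ≡⟨ cong (2 *_) (length-concat-tabulate (row A) row-filled) ⟩
    2 * (m * s)  ≡⟨ ℕ.*-assoc 2 m s ⟨
    2 * m * s    ∎
    where open ≡-Reasoning

  multipartite : IsCompleteMultipartite ((2 * n * k + t) / t) t K
  multipartite =
    -- The division is exact because `t` divides both `2 * n * k` and itself; the quotient, which
    -- serves as `q`, is positive because `t` is at most the dividend.
    cosetGraph-multipartite (trans v≡ (sym (m*[n/m]≡n (∣m∣n⇒∣m+n t∣2nk ∣-refl)))) J-sub ∣J∣≡t
    where
    instance
      parts-nonZero : NonZero ((2 * n * k + t) / t)
      parts-nonZero = >-nonZero (m≥n⇒m/n>0 (ℕ.m≤n+m t (2 * n * k)))
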